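{- Let $\mathcal F$ be a Fano plane, $\mathbb F$ a field of characteristic not $2$, $\epsilon$ a multiplication factor such that $(\mathbb O_{\mathcal F},\mathbf 1,\epsilon)$ is a composition algebra, and $n'\in V_{\mathcal F}^\ast\setminus\{0\}$. Let $\epsilon'_{PQ}=(-1)^{n'(P)n'(Q)}\epsilon_{PQ}$ for all $P\ne Q$ in $\mathcal F$ (so that $(\mathbb O_{\mathcal F},e^{n'},\epsilon')$ is a composition algebra). (i) If $(\mathbb O_{\mathcal F},\mathbf 1,\epsilon)\in\mathbb O_{\mathcal F}{}^+_1$, let $P_{n'}\in\mathcal F$ be the point whose future with respect to $\epsilon$ equals the line $\{Q\in\mathcal F:n'(Q)=0\}$. Then $P_{n'}$ is the unique point of $\mathcal F$ whose future with respect to $\epsilon'$ is $\mathcal F\setminus\{P_{n'}\}$. (ii) If $(\mathbb O_{\mathcal F},\mathbf 1,\epsilon)\in\mathbb O_{\mathcal F}{}^-_1$, let $P_{n'}\in\mathcal F$ be the point whose past with respect to $\epsilon$ equals the line $\{Q\in\mathcal F:n'(Q)=0\}$. Then $P_{n'}$ is the unique point of $\mathcal F$ whose past with respect to $\epsilon'$ is $\mathcal F\setminus\{P_{n'}\}$.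
   Context: A Fano plane is a set $\mathcal F$ of seven points together with a set of seven $3$-element subsets of $\mathcal F$ called lines, such that any two distinct points lie in a unique line and any two distinct lines meet in a unique point. The Fano cube is $V_{\mathcal F}=\mathcal F\cup\{0\}$ with the unique $\mathbb Z_2$-vector space structure with zero $0$ such that for distinct $P,Q\in\mathcal F$, $P+Q$ is the third point of the line through $P$ and $Q$; $V_{\mathcal F}^\ast$ is its dual. A norm on $\mathcal F$ is a map $N:\mathcal F\to\{ -1,1\}$ with $N(P+Q)=N(P)N(Q)$ for $P\ne Q$; for $n\in V_{\mathcal F}^\ast$, $e^{n}$ denotes the norm $P\mapsto(-1)^{n(P)}$, and $\mathbf 1=e^0$ is the trivial norm. A multiplication factor is a map $\epsilon:\{(P,Q)\in\mathcal F^2:P\ne Q\}\to\{ -1,1\}$ with $\epsilon_{QP}=-\epsilon_{PQ}$; the future of $P$ with respect to $\epsilon$ is $\{Q\ne P:\epsilon_{PQ}=1\}$ and the past is $\{Q\ne P:\epsilon_{PQ}=-1\}$. $\mathbb O_{\mathcal F}$ is the $\mathbb F$-vector space of $\mathbb F$-valued functions on $V_{\mathcal F}$, with basis $e_P$ ($P\in V_{\mathcal F}$), $e_P$ the indicator function of $P$. Given a norm $N$ and $\epsilon$, the multiplication $\cdot_\epsilon$ is bilinear with $e_P\cdot_\epsilon e_Q=\epsilon_{PQ}e_{P+Q}$ for $P\ne Q$ in $\mathcal F$, $e_P\cdot_\epsilon e_P=-N(P)e_0$ for $P\in\mathcal F$, and $e_0$ a two-sided unit; the quadratic form is $N_{\mathbb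 O}(\lambda^0e_0+\sum_P\lambda^Pe_P)=(\lambda^0)^2+\sum_PN(P)(\lambda^P)^2$. $(\mathbb O_{\mathcal F},N,\epsilon)$ is a composition algebra iff $N_{\mathbb O}(Z\cdot_\epsilon W)=N_{\mathbb O}(Z)N_{\mathbb O}(W)$ for all $Z,W$. $\mathbb O_{\mathcal F}{}^+_1$ (resp. $\mathbb O_{\mathcal F}{}^-_1$) is the set of composition algebras $(\mathbb O_{\mathcal F},\mathbf 1,\epsilon)$ such that the future (resp. past) of every point of $\mathcal F$ is a line. -}

module Defs where

open import Level using (Level; _⊔_) renaming (suc to lsuc)
open import Data.Bool using (Bool; true; false; _∧_; _xor_; not; if_then_else_)
open import Data.Nat using (ℕ; zero; suc)
open import Data.Fin using (Fin)
import Data.Fin as F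
open import Data.Fin.Properties using () renaming (_≟_ to _≟F_)
open import Data.Fin.Subset using (Subset; _∈_; ∣_∣)
open import Data.Fin.Subset.Properties using (_∈?_)
open import Data.Maybe using (Maybe; just; nothing)
import Data.Maybe.Properties as MP
open import Data.Product using (Σ; _×_; _,_; ∃; ∃-syntax)
import Data.Sign as S
open import Relation.Binary.PropositionalEquality using (_≡_; _≢_)
open import Relation.Nullary using (¬_; does)
open import Function.Bundles using (_⇔_)
open import Algebra.Bundles using (CommutativeRing)

------------------------------------------------------------------------
-- Fields: commutative rings with 1 ≠ 0 in which every nonzero element
-- has a multiplicative inverse.

record Field c ℓ : Set (lsuc (c ⊔ ℓ)) where
  field
    commutativeRing : CommutativeRing c ℓ
  open CommutativeRing commutativeRing public
  field
    1≉0     : ¬ (1# ≈ 0#)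
    inverse : ∀ x → ¬ (x ≈ 0#) → ∃[ y ] (x * y ≈ 1#)

-- characteristic not 2
CharNot2 : ∀ {c ℓ} → Field c ℓ → Set ℓ
CharNot2 𝔽 = ¬ (1# + 1# ≈ 0#) where open Field 𝔽

------------------------------------------------------------------------
-- Unique existence

∃!′ : {A : Set} → (A → Set) → Set
∃!′ {A} P = Σ A (λ x → P x × (∀ y → P y → y ≡ x))

------------------------------------------------------------------------
-- Fano planes.  The seven points are (w.l.o.g., up to renaming) the
-- elements of Fin 7; the seven lines are 3-element subsets, given by an
-- injective family indexed by Fin 7.

Pt : Set
Pt = Fin 7

record FanoPlane : Set where
  field
    line           : Fin 7 → Subset 7
    line-size      : ∀ i → ∣ line i ∣ ≡ 3
    line-injective : ∀ i j → line i ≡ line j → i ≡ j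
    two-points     : ∀ (P Q : Pt) → P ≢ Q → ∃!′ (λ i → P ∈ line i × Q ∈ line i)
    two-lines      : ∀ i j → i ≢ j → ∃!′ (λ (P : Pt) → P ∈ line i × P ∈ line j)

-- predicates on points and their extensional equality (set equality)
_≐_ : (Pt → Set) → (Pt → Set) → Set
A ≐ B = ∀ Q → A Q ⇔ B Q

-- boolean helpers on finite types
anyFin : ∀ {n} → (Fin n → Bool) → Bool
anyFin {zero}  f = false
anyFin {suc n} f = if f F.zero then true else anyFin (λ i → f (F.suc i))

firstFin : ∀ {n} → (Fin n → Bool) → Maybe (Fin n)
firstFin {zero}  f = nothing
firstFin {suc n} f with f F.zero
... | true  = just F.zero
... | false = Data.Maybe.map F.suc (firstFin (λ i → f (F.suc i)))
  where import Data.Maybe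

-- The Fano cube V_F = F ∪ {0}, with 0 represented by 'nothing'.
V : Set
V = Maybe Pt

module _ (FP : FanoPlane) where
  open FanoPlane FP

  -- R lies on a common line with P and Q
  collinear : Pt → Pt → Pt → Bool
  collinear P Q R = anyFin (λ i → does (P ∈? line i) ∧ does (Q ∈? line i) ∧ does (R ∈? line i))

  -- the third point of the line through distinct P and Q
  third : Pt → Pt → V
  third P Q = firstFin (λ R → not (does (R ≟F P)) ∧ not (does (R ≟F Q)) ∧ collinear P Q R)

  -- addition of the Fano cube
  _+V_ : V → V → V
  nothing +V y = y
  just P +V nothing = just P
  just P +V just Q = if does (P ≟F Q) then nothing else third P Q

  -- the line of points where a linear functional vanishes
  -- (dual space V_F^*: Z₂-linear maps V_F → Z₂, Z₂ = Bool with xor)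
  IsLinear : (V → Bool) → Set
  IsLinear n = ∀ x y → n (x +V y) ≡ n x xor n y

  Dual : Set
  Dual = Σ (V → Bool) IsLinear

  NonZeroDual : Dual → Set
  NonZeroDual (n , _) = ∃[ x ] n x ≡ true

-- norms (maps F → {-1,1}, with {-1,1} = Sign)
one : Pt → S.Sign
one _ = S.+

-- e^{n}
expN : (V → Bool) → Pt → S.Sign
expN n P = if n (just P) then S.- else S.+

-- multiplication factors (values on the diagonal are irrelevant)
MultFactor : Set
MultFactor = Pt → Pt → S.Sign

IsMultFactor : MultFactor → Set
IsMultFactor ε = ∀ P Q → P ≢ Q → ε Q P ≡ S.opposite (ε P Q)

-- ε'_{PQ} = (-1)^{n(P) n(Q)} ε_{PQ}
twist : (V → Bool) → MultFactor → MultFactor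
twist n ε P Q = if n (just P) ∧ n (just Q) then S.opposite (ε P Q) else ε P Q

-- future and past of P with respect to ε
Future : MultFactor → Pt → Pt → Set
Future ε P Q = Q ≢ P × ε P Q ≡ S.+

Past : MultFactor → Pt → Pt → Set
Past ε P Q = Q ≢ P × ε P Q ≡ S.-

-- F \ {P}
AllBut : Pt → Pt → Set
AllBut P Q = Q ≢ P

-- {Q : n(Q) = 0}
Kernel : (V → Bool) → Pt → Set
Kernel n Q = n (just Q) ≡ false

------------------------------------------------------------------------
-- The algebra O_F = functions V_F → 𝔽

sumFin : ∀ {a} {A : Set a} {n} → (A → A → A) → A → (Fin n → A) → A
sumFin {n = zero}  _+_ z f = z
sumFin {n = suc n} _+_ z f = f F.zero + sumFin _+_ z (λ i → f (F.suc i))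

module _ (FP : FanoPlane) {c ℓ} (𝔽 : Field c ℓ) where
  open Field 𝔽

  Oct : Set c
  Oct = V → Carrier

  sgn : S.Sign → Carrier
  sgn S.+ = 1#
  sgn S.- = - 1#

  sumV : (V → Carrier) → Carrier
  sumV f = f nothing + sumFin _+_ 0# (λ i → f (just i))

  -- structure constants: e_x ·ε e_y = coef x y e_{x+y}
  coef : (Pt → S.Sign) → MultFactor → V → V → Carrier
  coef N ε nothing  _        = 1#
  coef N ε (just P) nothing  = 1#
  coef N ε (just P) (just Q) = if does (P ≟F Q) then - sgn (N P) else sgn (ε P Q)

  mul : (Pt → S.Sign) → MultFactor → Oct → Oct → Oct
  mul N ε Z W R = sumV (λ x → sumV (λ y →
    if does (MP.≡-dec _≟F_ (_+V_ FP x y) R) then Z x * W y * coef N ε x y else 0#))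

  normO : (Pt → S.Sign) → Oct → Carrier
  normO N Z = Z nothing * Z nothing + sumFin _+_ 0# (λ P → sgn (N P) * (Z (just P) * Z (just P)))

  IsComposition : (Pt → S.Sign) → MultFactor → Set (c ⊔ ℓ)
  IsComposition N ε = ∀ (Z W : Oct) → normO N (mul N ε Z W) ≈ normO N Z * normO N W

  -- O_F^+_1 and O_F^-_1
  InPlus1 : MultFactor → Set (c ⊔ ℓ)
  InPlus1 ε = IsComposition one ε × (∀ P → ∃[ i ] (Future ε P ≐ (λ Q → Q ∈ FanoPlane.line FP i)))

  InMinus1 : MultFactor → Set (c ⊔ ℓ)
  InMinus1 ε = IsComposition one ε × (∀ P → ∃[ i ] (Past ε P ≐ (λ Q → Q ∈ FanoPlane.line FP i)))

{-# OPTIONS --safe #-}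
module Submission where

-- A nonzero functional n takes the value 1 on an even number of points of every line, from which its
-- kernel is a line. Distinct points P ≠ P′ have distinct cones (futures, or pasts): by antisymmetry of ε
-- one of them lies in the other's cone but not in its own. So when every cone is a line, the cones run
-- through all seven lines and some P has the kernel of n as its cone. This P lies off the kernel, so the
-- twist flips ε P Q exactly for the Q outside its cone, and every other point joins the twisted cone of P;
-- antisymmetry of the twisted factor leaves room for only one such point.

open import Defs

open import Data.Bool using (Bool; true; false; T; not; _∧_; _xor_)
open import Data.Bool.Properties using (T-≡; T-∧; xor-same)
open import Data.Fin using (Fin; punchOut)
import Data.Fin as F
open import Data.Fin.Properties
  using (suc-injective; punchInᵢ≢i; any?; all?; ¬∀⟶∃¬; injective⇒≤; punchOut-injective)
  renaming (_≟_ to _≟F_)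
open import Data.Fin.Subset using (Subset; _∈_; _∉_; ∣_∣; _-_; ⊤; Nonempty; inside; outside)
open import Data.Fin.Subset.Properties
  using (_∈?_; ∣⊤∣≡n; p⊆q⇒∣p∣≤∣q∣; p─⊥≡p; x∈p∧x≢y⇒x∈p-y; p─q⊆p; nonempty?; Empty-unique; ∣⊥∣≡0)
import Data.Maybe as Maybe
open import Data.Maybe using (just; nothing)
open import Data.Nat using (suc; _<_; _≤_; s≤s; z≤n)
import Data.Nat.Properties as ℕ
open import Data.Product using (Σ; _×_; _,_; proj₁; proj₂; map₂; ∃; ∃₂; ∃-syntax)
import Data.Sign as S
import Data.Sign.Properties as S
open import Data.Sum using (_⊎_; inj₁; inj₂)
open import Data.Vec using (_∷_; here; there)
open import Function using (_∘_)
open import Function.Bundles using (_⇔_; mk⇔; Equivalence)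
open import Function.Definitions using (Injective)
import Function.Properties.Equivalence as ⇔
open import Relation.Binary.PropositionalEquality
open import Relation.Nullary using (¬_; Dec; does; yes; no; contradiction)
open import Relation.Nullary.Decidable using (dec-false)

open Equivalence using (to; from)

∣p∣≡1+∣p-x∣ : ∀ {n} {p : Subset n} {x} → x ∈ p → ∣ p ∣ ≡ suc ∣ p - x ∣
∣p∣≡1+∣p-x∣ {p = inside ∷ p} here = cong (suc ∘ ∣_∣) (sym (p─⊥≡p p))
∣p∣≡1+∣p-x∣ {p = inside ∷ p} (there x∈p) = cong suc (∣p∣≡1+∣p-x∣ x∈p)
∣p∣≡1+∣p-x∣ {p = outside ∷ p} (there x∈p) = ∣p∣≡1+∣p-x∣ x∈p

x∉p-x : ∀ {n} {p : Subset n} x → x ∉ p - x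
x∉p-x {p = _ ∷ _} F.zero ()
x∉p-x {p = _ ∷ _} (F.suc x) (there x∈p-x) = x∉p-x x x∈p-x

x∈p-y⇒x≢y : ∀ {n} {p : Subset n} {x y} → x ∈ p - y → x ≢ y
x∈p-y⇒x≢y {x = x} x∈p-x refl = x∉p-x x x∈p-x

x∈p-y⇒x∈p : ∀ {n} {p : Subset n} {x y} → x ∈ p - y → x ∈ p
x∈p-y⇒x∈p {p = p} = p─q⊆p p _

∣p∣≡1+k⇒nonempty : ∀ {n k} {p : Subset n} → ∣ p ∣ ≡ suc k → Nonempty p
∣p∣≡1+k⇒nonempty {n} {p = p} ∣p∣≡1+k with nonempty? p
... | yes ne = ne
... | no ¬ne with () ← trans (sym ∣p∣≡1+k) (trans (cong ∣_∣ (Empty-unique ¬ne)) (∣⊥∣≡0 n))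

∣p∣≡0⇒x∉p : ∀ {n} {p : Subset n} {x} → ∣ p ∣ ≡ 0 → x ∉ p
∣p∣≡0⇒x∉p ∣p∣≡0 x∈p with () ← trans (sym ∣p∣≡0) (∣p∣≡1+∣p-x∣ x∈p)

∣p∣<n⇒∃∉ : ∀ {n} {p : Subset n} → ∣ p ∣ < n → ∃ λ x → x ∉ p
∣p∣<n⇒∃∉ {n} {p} ∣p∣<n with all? (_∈? p)
... | yes ⊤⊆p = contradiction (subst (_≤ ∣ p ∣) (∣⊤∣≡n n) (p⊆q⇒∣p∣≤∣q∣ {p = ⊤} (λ _ → ⊤⊆p _))) (ℕ.<⇒≱ ∣p∣<n)
... | no ¬⊤⊆p = ¬∀⟶∃¬ n (_∈ p) (_∈? p) ¬⊤⊆p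

module _ {n} {p : Subset n} (∣p∣≡3 : ∣ p ∣ ≡ 3) {P Q} (P∈p : P ∈ p) (Q∈p : Q ∈ p) (Q≢P : Q ≢ P) where

  private
    ∣p-P-Q∣≡1 : ∣ p - P - Q ∣ ≡ 1
    ∣p-P-Q∣≡1 = ℕ.suc-injective (ℕ.suc-injective (begin
      suc (suc ∣ p - P - Q ∣) ≡⟨ cong suc (∣p∣≡1+∣p-x∣ (x∈p∧x≢y⇒x∈p-y Q∈p Q≢P)) ⟨
      suc ∣ p - P ∣           ≡⟨ ∣p∣≡1+∣p-x∣ P∈p ⟨
      ∣ p ∣                   ≡⟨ ∣p∣≡3 ⟩
      3                       ∎))
      where open ≡-Reasoning

  third-member : ∃ λ R → R ∈ p × R ≢ P × R ≢ Q
  third-member with R , R∈p-P-Q ← ∣p∣≡1+k⇒nonempty ∣p-P-Q∣≡1 =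
    R , x∈p-y⇒x∈p R∈p-P , x∈p-y⇒x≢y R∈p-P , x∈p-y⇒x≢y {p = p - P} R∈p-P-Q
    where
    R∈p-P : R ∈ p - P
    R∈p-P = x∈p-y⇒x∈p {p = p - P} R∈p-P-Q

  member-of-triple : ∀ {R S} → R ∈ p → R ≢ P → R ≢ Q → S ∈ p → S ≡ P ⊎ S ≡ Q ⊎ S ≡ R
  member-of-triple {R} {S} R∈p R≢P R≢Q S∈p with S ≟F P | S ≟F Q | S ≟F R
  ... | yes S≡P | _ | _ = inj₁ S≡P
  ... | no _ | yes S≡Q | _ = inj₂ (inj₁ S≡Q)
  ... | no _ | no _ | yes S≡R = inj₂ (inj₂ S≡R)
  ... | no S≢P | no S≢Q | no S≢R = contradiction S∈p-P-Q-R (∣p∣≡0⇒x∉p ∣p-P-Q-R∣≡0)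
    where
    ∣p-P-Q-R∣≡0 : ∣ p - P - Q - R ∣ ≡ 0
    ∣p-P-Q-R∣≡0 = sym (ℕ.suc-injective (trans (sym ∣p-P-Q∣≡1)
      (∣p∣≡1+∣p-x∣ (x∈p∧x≢y⇒x∈p-y (x∈p∧x≢y⇒x∈p-y R∈p R≢P) R≢Q))))
    S∈p-P-Q-R : S ∈ p - P - Q - R
    S∈p-P-Q-R = x∈p∧x≢y⇒x∈p-y (x∈p∧x≢y⇒x∈p-y (x∈p∧x≢y⇒x∈p-y S∈p S≢P) S≢Q) S≢R

injective⇒surjective : ∀ {n} {f : Fin n → Fin n} → Injective _≡_ _≡_ f → ∀ j → ∃ λ i → f i ≡ j
injective⇒surjective {suc n} {f} f-inj j with any? (λ i → f i ≟F j)
... | yes hit = hit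
... | no miss = contradiction (injective⇒≤ punchOut∘f-injective) ℕ.1+n≰n
  where
  punchOut∘f : Fin (suc n) → Fin n
  punchOut∘f i = punchOut {i = j} (λ j≡fi → miss (i , sym j≡fi))
  punchOut∘f-injective : Injective _≡_ _≡_ punchOut∘f
  punchOut∘f-injective = f-inj ∘ punchOut-injective {i = j} _ _

T-does : ∀ {A : Set} (a? : Dec A) → T (does a?) ⇔ A
T-does (yes a) = mk⇔ (λ _ → a) _
T-does (no ¬a) = mk⇔ (λ ()) ¬a

T-not-does : ∀ {A : Set} (a? : Dec A) → T (not (does a?)) ⇔ (¬ A)
T-not-does (yes a) = mk⇔ (λ ()) (λ ¬a → ¬a a)
T-not-does (no ¬a) = mk⇔ (λ _ → ¬a) _

anyFin⁺ : ∀ {n} (f : Fin n → Bool) {i} → T (f i) → T (anyFin f)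
anyFin⁺ f {F.zero} fi with f F.zero
... | true = _
anyFin⁺ f {F.suc i} fi with f F.zero
... | true = _
... | false = anyFin⁺ (f ∘ F.suc) fi

anyFin⁻ : ∀ {n} (f : Fin n → Bool) → T (anyFin f) → ∃ λ i → T (f i)
anyFin⁻ {suc n} f any-f with f F.zero in f0≡b
... | true = F.zero , from T-≡ f0≡b
... | false with i , fi ← anyFin⁻ (f ∘ F.suc) any-f = F.suc i , fi

firstFin-unique : ∀ {n} (f : Fin n → Bool) {R} → T (f R) → (∀ S → T (f S) → S ≡ R) → firstFin f ≡ just R
firstFin-unique {suc n} f {R} fR unique with f F.zero in f0≡b
... | true = cong just (unique F.zero (from T-≡ f0≡b))
firstFin-unique {suc n} f {F.zero} fR unique | false = contradiction (subst T f0≡b fR) (λ ())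
firstFin-unique {suc n} f {F.suc R} fR unique | false =
  cong (Maybe.map F.suc) (firstFin-unique (f ∘ F.suc) fR (λ S fS → suc-injective (unique (F.suc S) fS)))

module FanoGeometry (FP : FanoPlane) where
  open FanoPlane FP

  line-through : ∀ {P Q} → P ≢ Q → ∃ λ i → P ∈ line i × Q ∈ line i
  line-through P≢Q = map₂ proj₁ (two-points _ _ P≢Q)

  line-unique : ∀ {P Q i j} → P ≢ Q → P ∈ line i → Q ∈ line i → P ∈ line j → Q ∈ line j → i ≡ j
  line-unique P≢Q P∈i Q∈i P∈j Q∈j with _ , _ , unique ← two-points _ _ P≢Q =
    trans (unique _ (P∈i , Q∈i)) (sym (unique _ (P∈j , Q∈j)))

  collinear⇔ : ∀ {P Q R} → T (collinear FP P Q R) ⇔ (∃ λ i → P ∈ line i × Q ∈ line i × R ∈ line i)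
  collinear⇔ {P} {Q} {R} = mk⇔
    (λ t → let i , t′ = anyFin⁻ onLine t ; P∈ , t″ = to T-∧ t′ ; Q∈ , R∈ = to T-∧ t″
           in i , to (T-does (P ∈? line i)) P∈ , to (T-does (Q ∈? line i)) Q∈ , to (T-does (R ∈? line i)) R∈)
    (λ (i , P∈ , Q∈ , R∈) → anyFin⁺ onLine {i}
      (from T-∧ (from (T-does (P ∈? line i)) P∈ , from T-∧ (from (T-does (Q ∈? line i)) Q∈ , from (T-does (R ∈? line i)) R∈))))
    where
    onLine : Fin 7 → Bool
    onLine i = does (P ∈? line i) ∧ does (Q ∈? line i) ∧ does (R ∈? line i)

  module _ {P Q R i} (P≢Q : P ≢ Q) (R≢P : R ≢ P) (R≢Q : R ≢ Q)
           (P∈i : P ∈ line i) (Q∈i : Q ∈ line i) (R∈i : R ∈ line i) where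

    third-on-line : third FP P Q ≡ just R
    third-on-line = firstFin-unique isThird R-isThird only-R
      where
      isThird : Pt → Bool
      isThird S = not (does (S ≟F P)) ∧ not (does (S ≟F Q)) ∧ collinear FP P Q S
      R-isThird : T (isThird R)
      R-isThird = from T-∧ (from (T-not-does (R ≟F P)) R≢P ,
                  from T-∧ (from (T-not-does (R ≟F Q)) R≢Q , from collinear⇔ (i , P∈i , Q∈i , R∈i)))
      only-R : ∀ S → T (isThird S) → S ≡ R
      only-R S t with S≢P , t′ ← to T-∧ t
        with S≢Q , S-col ← to T-∧ t′
        with j , P∈j , Q∈j , S∈j ← to collinear⇔ S-col
        with refl ← line-unique P≢Q P∈i Q∈i P∈j Q∈j
        with member-of-triple (line-size i) P∈i Q∈i (P≢Q ∘ sym) R∈i R≢P R≢Q S∈j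
      ... | inj₁ S≡P = contradiction S≡P (to (T-not-does (S ≟F P)) S≢P)
      ... | inj₂ (inj₁ S≡Q) = contradiction S≡Q (to (T-not-does (S ≟F Q)) S≢Q)
      ... | inj₂ (inj₂ S≡R) = S≡R

    +V-on-line : _+V_ FP (just P) (just Q) ≡ just R
    +V-on-line rewrite dec-false (P ≟F Q) P≢Q = third-on-line

    linear-on-line : ∀ (n : Dual FP) → proj₁ n (just R) ≡ proj₁ n (just P) xor proj₁ n (just Q)
    linear-on-line (n , n-linear) = trans (cong n (sym +V-on-line)) (n-linear (just P) (just Q))

  module _ (n : Dual FP) (n≢0 : NonZeroDual FP n) where
    private
      n̂ : V → Bool
      n̂ = proj₁ n

      n̂-nothing≡false : n̂ nothing ≡ false
      n̂-nothing≡false = trans (proj₂ n nothing nothing) (xor-same (n̂ nothing))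

      separates : ∀ {P Q} → n̂ (just P) ≡ true → n̂ (just Q) ≡ false → P ≢ Q
      separates nP nQ refl with () ← trans (sym nP) nQ

      off-kernel : ∃ λ a → n̂ (just a) ≡ true
      off-kernel = point n≢0
        where
        point : NonZeroDual FP n → ∃ λ a → n̂ (just a) ≡ true
        point (just a , na) = a , na
        point (nothing , n0) with () ← trans (sym n̂-nothing≡false) n0

      a : Pt
      a = proj₁ off-kernel

      na : n̂ (just a) ≡ true
      na = proj₂ off-kernel

    kernel-meets-line : ∀ {b i} → b ≢ a → a ∈ line i → b ∈ line i → ∃ λ k → k ∈ line i × Kernel n̂ k
    kernel-meets-line {b} {i} b≢a a∈i b∈i with n̂ (just b) in nb
    ... | false = b , b∈i , nb
    ... | true with c , c∈i , c≢a , c≢b ← third-member (line-size i) a∈i b∈i b≢a =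
      c , c∈i , trans (linear-on-line (b≢a ∘ sym) c≢a c≢b a∈i b∈i c∈i n) (cong₂ _xor_ na nb)

    line-in-kernel : ∀ {k₁ k₂ j} → k₁ ≢ k₂ → k₁ ∈ line j → k₂ ∈ line j → Kernel n̂ k₁ → Kernel n̂ k₂ →
                     ∀ {Q} → Q ∈ line j → Kernel n̂ Q
    line-in-kernel {k₁} {k₂} k₁≢k₂ k₁∈j k₂∈j nk₁ nk₂ {Q} Q∈j with Q ≟F k₁ | Q ≟F k₂
    ... | yes refl | _ = nk₁
    ... | no _ | yes refl = nk₂
    ... | no Q≢k₁ | no Q≢k₂ = trans (linear-on-line k₁≢k₂ Q≢k₁ Q≢k₂ k₁∈j k₂∈j Q∈j n) (cong₂ _xor_ nk₁ nk₂)

    -- If Q were a kernel point off j, the line through a and Q would meet j in a kernel point m, forcing n(a) = n(Q) + n(m) = 0.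
    kernel-in-line : ∀ {j} → (∀ {Q} → Q ∈ line j → Kernel n̂ Q) → ∀ {Q} → Kernel n̂ Q → Q ∈ line j
    kernel-in-line {j} j⊆ker {Q} nQ with Q ∈? line j
    ... | yes Q∈j = Q∈j
    ... | no Q∉j with i , a∈i , Q∈i ← line-through (separates na nQ)
      with m , (m∈i , m∈j) , _ ← two-lines i j (λ { refl → Q∉j Q∈i })
      = contradiction (trans (sym na) n̂a≡false) λ ()
      where
      n̂a≡false : n̂ (just a) ≡ false
      n̂a≡false = trans (linear-on-line (λ { refl → Q∉j m∈j }) (separates na nQ) (separates na (j⊆ker m∈j))
                  Q∈i m∈i a∈i n) (cong₂ _xor_ nQ (j⊆ker m∈j))

    -- Both lines through a and a point b resp. d (d off the first line) carry a kernel point, and these differ.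
    two-kernel-points : ∃₂ λ k₁ k₂ → k₁ ≢ k₂ × Kernel n̂ k₁ × Kernel n̂ k₂
    two-kernel-points
      with i₀ , a∈i₀ , b∈i₀ ← line-through (punchInᵢ≢i a F.zero ∘ sym)
      with k₁ , k₁∈i₀ , nk₁ ← kernel-meets-line (punchInᵢ≢i a F.zero) a∈i₀ b∈i₀
      with d , d∉i₀ ← ∣p∣<n⇒∃∉ (subst (_< 7) (sym (line-size i₀)) (s≤s (s≤s (s≤s (s≤s z≤n)))))
      with i₁ , a∈i₁ , d∈i₁ ← line-through {a} {d} (λ { refl → d∉i₀ a∈i₀ })
      with k₂ , k₂∈i₁ , nk₂ ← kernel-meets-line (λ { refl → d∉i₀ a∈i₀ }) a∈i₁ d∈i₁
      = k₁ , k₂ , k₁≢k₂ , nk₁ , nk₂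
      where
      k₁≢k₂ : k₁ ≢ k₂
      k₁≢k₂ refl = d∉i₀ (subst (λ i → d ∈ line i)
        (line-unique (separates na nk₁) a∈i₁ k₂∈i₁ a∈i₀ k₁∈i₀) d∈i₁)

    line-through-kernel-points : ∀ {k₁ k₂} → k₁ ≢ k₂ → Kernel n̂ k₁ → Kernel n̂ k₂ →
                                 ∃ λ j → (λ Q → Q ∈ line j) ≐ Kernel n̂
    line-through-kernel-points k₁≢k₂ nk₁ nk₂ with j , k₁∈j , k₂∈j ← line-through k₁≢k₂ =
      j , λ Q → mk⇔ j⊆ker (kernel-in-line j⊆ker)
      where
      j⊆ker : ∀ {Q} → Q ∈ line j → Kernel n̂ Q
      j⊆ker = line-in-kernel k₁≢k₂ k₁∈j k₂∈j nk₁ nk₂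

    kernel-is-line : ∃ λ j → (λ Q → Q ∈ line j) ≐ Kernel n̂
    kernel-is-line = let _ , _ , k₁≢k₂ , nk₁ , nk₂ = two-kernel-points in line-through-kernel-points k₁≢k₂ nk₁ nk₂

-- Cone S.+ ε P is the future of P and Cone S.- ε P its past.
Cone : S.Sign → MultFactor → Pt → Pt → Set
Cone s ε P Q = Q ≢ P × ε P Q ≡ s

≢⇒opposite≡ : ∀ {s t} → t ≢ s → S.opposite t ≡ s
≢⇒opposite≡ {S.+} {S.+} t≢s = contradiction refl t≢s
≢⇒opposite≡ {S.+} {S.-} _ = refl
≢⇒opposite≡ {S.-} {S.+} _ = refl
≢⇒opposite≡ {S.-} {S.-} t≢s = contradiction refl t≢s

module _ {ε : MultFactor} (ε-anti : IsMultFactor ε) (s : S.Sign) where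

  cone⊎reverse-cone : ∀ {P Q} → Q ≢ P → Cone s ε P Q ⊎ Cone s ε Q P
  cone⊎reverse-cone {P} {Q} Q≢P with ε P Q S.≟ s
  ... | yes εPQ≡s = inj₁ (Q≢P , εPQ≡s)
  ... | no εPQ≢s = inj₂ ((Q≢P ∘ sym) , trans (ε-anti P Q (Q≢P ∘ sym)) (≢⇒opposite≡ εPQ≢s))

  full-cone-unique : ∀ {P Q} → Cone s ε P ≐ AllBut P → Cone s ε Q ≐ AllBut Q → Q ≡ P
  full-cone-unique {P} {Q} P-full Q-full with Q ≟F P
  ... | yes Q≡P = Q≡P
  ... | no Q≢P = contradiction s≡-s (S.s≢opposite[s] s)
    where
    open ≡-Reasoning
    s≡-s : s ≡ S.opposite s
    s≡-s = begin
      s                   ≡⟨ proj₂ (from (Q-full P) (Q≢P ∘ sym)) ⟨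
      ε Q P               ≡⟨ ε-anti P Q (Q≢P ∘ sym) ⟩
      S.opposite (ε P Q)  ≡⟨ cong S.opposite (proj₂ (from (P-full Q) Q≢P)) ⟩
      S.opposite s        ∎

  module _ (FP : FanoPlane) (cone-line : ∀ P → ∃[ i ] (Cone s ε P ≐ (λ Q → Q ∈ FanoPlane.line FP i))) where
    open FanoPlane FP

    same-line⇒same-cone : ∀ {P P′ Q} → proj₁ (cone-line P) ≡ proj₁ (cone-line P′) → Cone s ε P Q → Cone s ε P′ Q
    same-line⇒same-cone {P} {P′} {Q} same-line Q∈P = from (proj₂ (cone-line P′) Q)
      (subst (λ i → Q ∈ line i) same-line (to (proj₂ (cone-line P) Q) Q∈P))

    cone-line-injective : Injective _≡_ _≡_ (proj₁ ∘ cone-line)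
    cone-line-injective {P} {P′} same-line with P ≟F P′
    ... | yes P≡P′ = P≡P′
    ... | no P≢P′ with cone⊎reverse-cone (P≢P′ ∘ sym)
    ... | inj₁ P′∈P = contradiction refl (proj₁ (same-line⇒same-cone same-line P′∈P))
    ... | inj₂ P∈P′ = contradiction refl (proj₁ (same-line⇒same-cone (sym same-line) P∈P′))

    every-line-is-a-cone : ∀ j → ∃ λ P → Cone s ε P ≐ (λ Q → Q ∈ line j)
    every-line-is-a-cone j =
      let P , line-P≡j = injective⇒surjective cone-line-injective j
      in  P , subst (λ i → Cone s ε P ≐ (λ Q → Q ∈ line i)) line-P≡j (proj₂ (cone-line P))

    kernel-cone : ∀ (n : Dual FP) → NonZeroDual FP n → ∃ λ P → Cone s ε P ≐ Kernel (proj₁ n)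
    kernel-cone n n≢0 =
      let j , j≐ker   = FanoGeometry.kernel-is-line FP n n≢0
          P , cone≐j  = every-line-is-a-cone j
      in  P , λ Q → ⇔.trans (cone≐j Q) (j≐ker Q)

module _ (n̂ : V → Bool) {ε : MultFactor} where

  twist-isMultFactor : IsMultFactor ε → IsMultFactor (twist n̂ ε)
  twist-isMultFactor ε-anti P Q P≢Q with n̂ (just P) | n̂ (just Q)
  ... | true  | true  = cong S.opposite (ε-anti P Q P≢Q)
  ... | true  | false = ε-anti P Q P≢Q
  ... | false | true  = ε-anti P Q P≢Q
  ... | false | false = ε-anti P Q P≢Q

  kernel-cone⇒full-twisted-cone : ∀ {s P} → Cone s ε P ≐ Kernel n̂ → Cone s (twist n̂ ε) P ≐ AllBut P
  kernel-cone⇒full-twisted-cone {s} {P} cone≐ker Q = mk⇔ proj₁ (λ Q≢P → Q≢P , twisted Q≢P)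
    where
    n̂P≡true : n̂ (just P) ≡ true
    n̂P≡true with n̂ (just P) in n̂P
    ... | true = refl
    ... | false = contradiction refl (proj₁ (from (cone≐ker P) n̂P))

    twisted : Q ≢ P → twist n̂ ε P Q ≡ s
    twisted Q≢P rewrite n̂P≡true with n̂ (just Q) in n̂Q
    ... | false = proj₂ (from (cone≐ker Q) n̂Q)
    ... | true = ≢⇒opposite≡ (λ εPQ≡s → contradiction (trans (sym n̂Q) (to (cone≐ker Q) (Q≢P , εPQ≡s))) λ ())

corollary4p7 : (FP : FanoPlane) → ∀ {c ℓ} (𝔽 : Field c ℓ) → CharNot2 𝔽 →
    (ε : MultFactor) → IsMultFactor ε → IsComposition FP 𝔽 one ε →
    (n′ : Dual FP) → NonZeroDual FP n′ →
    (InPlus1 FP 𝔽 ε →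
      Σ Pt (λ P → Future ε P ≐ Kernel (proj₁ n′)) ×
      (∀ P → Future ε P ≐ Kernel (proj₁ n′) →
        (Future (twist (proj₁ n′) ε) P ≐ AllBut P) ×
        (∀ Q → Future (twist (proj₁ n′) ε) Q ≐ AllBut Q → Q ≡ P)))
    ×
    (InMinus1 FP 𝔽 ε →
      Σ Pt (λ P → Past ε P ≐ Kernel (proj₁ n′)) ×
      (∀ P → Past ε P ≐ Kernel (proj₁ n′) →
        (Past (twist (proj₁ n′) ε) P ≐ AllBut P) ×
        (∀ Q → Past (twist (proj₁ n′) ε) Q ≐ AllBut Q → Q ≡ P)))
corollary4p7 FP 𝔽 _ ε ε-anti _ n′ n′≢0 = cones-in-lines S.+ ∘ proj₂ , cones-in-lines S.- ∘ proj₂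
  where
  n̂ : V → Bool
  n̂ = proj₁ n′
  cones-in-lines : ∀ s → (∀ P → ∃[ i ] (Cone s ε P ≐ (λ Q → Q ∈ FanoPlane.line FP i))) →
    Σ Pt (λ P → Cone s ε P ≐ Kernel n̂) ×
    (∀ P → Cone s ε P ≐ Kernel n̂ →
      (Cone s (twist n̂ ε) P ≐ AllBut P) × (∀ Q → Cone s (twist n̂ ε) Q ≐ AllBut Q → Q ≡ P))
  cones-in-lines s cone-line =
    kernel-cone ε-anti s FP cone-line n′ n′≢0 ,
    λ P P-cone≐ker → kernel-cone⇒full-twisted-cone n̂ {ε} P-cone≐ker ,
      λ Q Q-full → full-cone-unique (twist-isMultFactor n̂ ε-anti) s (kernel-cone⇒full-twisted-cone n̂ {ε} P-cone≐ker) Q-full
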